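{- Let $t \geq 1$ and $k \geq 1$ be integers, and let $\mathcal{F}$ be a finite family of finite sets with $\alpha(\mathcal{F}) \geq t$. Let $\mathcal{A}_1, \dots, \mathcal{A}_k$ be cross-$t$-intersecting sub-families of $\mathcal{F}$. If $k \geq \kappa(\mathcal{F},t)$, then \[\sum_{i=1}^k |\mathcal{A}_i| \leq k\, l(\mathcal{F},t) \quad \text{and} \quad \prod_{i=1}^k |\mathcal{A}_i| \leq \left(l(\mathcal{F},t)\right)^k,\] and both bounds are attained if $\mathcal{A}_1 = \dots = \mathcal{A}_k = \mathcal{L}$ for some largest $t$-intersecting sub-family $\mathcal{L}$ of $\mathcal{F}$. Moreover, if $k > \kappa(\mathcal{F},t)$, then in both inequalities equality holds only if $\mathcal{A}_1 = \dots = \mathcal{A}_k = \mathcal{L}$ for some largest $t$-intersecting sub-family $\mathcal{L}$ of $\mathcal{F}$.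
   Context: All sets and families are finite. A set $A$ $t$-intersects a set $B$ if $|A \cap B| \geq t$. A family $\mathcal{A}$ is $t$-intersecting if $|A \cap B| \geq t$ for all $A, B \in \mathcal{A}$ with $A \neq B$. Families $\mathcal{A}_1, \dots, \mathcal{A}_k$ (not necessarily distinct or non-empty) are cross-$t$-intersecting if for all $i \neq j$ in $\{1,\dots,k\}$, $|A \cap B| \geq t$ for every $A \in \mathcal{A}_i$ and $B \in \mathcal{A}_j$. For a non-empty family $\mathcal{F}$: $\alpha(\mathcal{F}) = \max\{|F| : F \in \mathcal{F}\}$; $l(\mathcal{F},t)$ is the size of a largest $t$-intersecting sub-family of $\mathcal{F}$. For a family $\mathcal{A}$, $\mathcal{A}^{t,+} = \{A \in \mathcal{A} : |A \cap B| \geq t \text{ for all } B \in \mathcal{A} \text{ with } B \neq A\}$ and $\mathcal{A}^{t,- } = \mathcal{A} \setminus \mathcal{A}^{t,+}$. For $\mathcal{A} \subseteq \mathcal{F}$, $\beta(\mathcal{F},t,\mathcal{A}) = \frac{l(\mathcal{F},t) - |\mathcal{A}^{t,+}|}{|\mathcal{A}^{t,- }|}$ if $\mathcal{A}^{t,- } \neq \emptyset$, and $\beta(\mathcal{F},t,\mathcal{A}) = \frac{l(\mathcal{F},t)}{|\mathcal{F}|}$ if $\mathcal{A}^{t,- } = \emptyset$. Then $\beta(\mathcal{F},t) = \min\{\beta(\mathcal{F},t,\mathcal{A}) : \mathcal{A} \subseteq \mathcal{F}\}$ (which is positive) and $\kappa(\mathcal{F},t) = 1/\beta(\mathcal{F},t)$.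 -}

module Defs where

open import Data.Bool.Base using (true)
open import Data.Fin.Base using (Fin; zero)
open import Data.Fin.Properties using (all?) renaming (_≟_ to _≟ᶠ_)
open import Data.Fin.Subset
  using (Subset; inside; outside; _∈_; _∉_; _∩_; _∪_; _─_; ∣_∣; ⁅_⁆; Nonempty)
  renaming (⊥ to ∅)
open import Data.Fin.Subset.Properties
  using (_∈?_; nonempty?; ∣⊥∣≡0; Empty-unique; ∣⁅x⁆∣≡1; x∈⁅x⁆; x∈⁅y⁆⇒x≡y;
         p⊂q⇒∣p∣<∣q∣; p⊆p∪q; q⊆p∪q; x∈p∪q⁻; ∩-comm; p─q⊆p)
open import Data.Integer.Base as ℤ using (+_)
import Data.Integer.Properties as ℤ
open import Data.List.Base using (List; [_]; _++_; map; filter; allFin)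
import Data.List.Base as List
open import Data.List.Extrema.Nat using (max; xs≤max)
open import Data.List.Membership.Propositional using () renaming (_∈_ to _∈ˡ_)
open import Data.List.Membership.Propositional.Properties
  using (∈-map⁺; ∈-++⁺ˡ; ∈-++⁺ʳ; ∈-filter⁺)
import Data.List.Relation.Unary.All as All
import Data.List.Relation.Unary.All.Properties as All
open import Data.List.Relation.Unary.Any using (here)
open import Data.Nat.Base using (ℕ; zero; suc; _≤_; _<_; _∸_; NonZero; >-nonZero; z<s)
import Data.Nat.ListAction as ℕ
import Data.Nat.Properties as ℕ
open import Data.Product.Base using (_×_; _,_; proj₁; proj₂)
open import Data.Rational.Base using (ℚ; _/_; 1/_; Positive)
import Data.Rational.Properties as ℚ
open import Relation.Binary.Bundles using (DecTotalOrder)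
open import Data.List.Extrema (DecTotalOrder.totalOrder ℚ.≤-decTotalOrder)
  using (argmin-all) renaming (min to minℚ)
open import Data.Sum.Base using (inj₁; inj₂)
import Data.Vec.Base as Vec
open import Data.Vec.Properties using (lookup∘tabulate; []=⇒lookup)
open import Function.Base using (id)
open import Function.Bundles using (_↣_; Injection)
open import Relation.Binary.PropositionalEquality
  using (_≡_; _≢_; refl; sym; trans; cong; subst)
open import Relation.Nullary using (Dec; yes; no; does; ¬?; contradiction)
open import Relation.Nullary.Decidable using (_×-dec_; _→-dec_; dec-true)

-- A family of m sets, all contained in a ground set of n points: the a-th
-- member is F a, and injectivity says that distinct indices carry distinct
-- sets.  Hence the sub-families of F are the subsets of the index set Fin m,
-- with the same cardinality, and equality of sub-families is _≡_.
Family : ℕ → ℕ → Set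
Family m n = Fin m ↣ Subset n

member : ∀ {m n} → Family m n → Fin m → Subset n
member = Injection.to

-- The default 0 of max is irrelevant for non-empty families.
α : ∀ {m n} → Family m n → ℕ
α {m} F = max 0 (map (λ a → ∣ member F a ∣) (allFin m))

-- b ≢ a is the same as member F b ≢ member F a, by injectivity.
IntersectsOthers : ∀ {m n} → Family m n → ℕ → Subset m → Fin m → Set
IntersectsOthers F t 𝒜 a =
  ∀ b → b ∈ 𝒜 → b ≢ a → t ≤ ∣ member F a ∩ member F b ∣

Intersecting : ∀ {m n} → Family m n → ℕ → Subset m → Set
Intersecting F t 𝒜 = ∀ a → a ∈ 𝒜 → IntersectsOthers F t 𝒜 a

CrossIntersecting : ∀ {m n k} → Family m n → ℕ → (Fin k → Subset m) → Set
CrossIntersecting F t 𝒜 =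
  ∀ i j → i ≢ j → ∀ a b → a ∈ 𝒜 i → b ∈ 𝒜 j → t ≤ ∣ member F a ∩ member F b ∣

LargestIntersecting : ∀ {m n} → Family m n → ℕ → Subset m → Set
LargestIntersecting F t ℒ =
  Intersecting F t ℒ × (∀ 𝒜 → Intersecting F t 𝒜 → ∣ 𝒜 ∣ ≤ ∣ ℒ ∣)

intersectsOthers? : ∀ {m n} (F : Family m n) t 𝒜 a → Dec (IntersectsOthers F t 𝒜 a)
intersectsOthers? F t 𝒜 a = all? λ b →
  (b ∈? 𝒜) →-dec (¬? (b ≟ᶠ a) →-dec (t ℕ.≤? ∣ member F a ∩ member F b ∣))

intersecting? : ∀ {m n} (F : Family m n) t 𝒜 → Dec (Intersecting F t 𝒜)
intersecting? F t 𝒜 = all? λ a → (a ∈? 𝒜) →-dec intersectsOthers? F t 𝒜 a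

subsets : ∀ m → List (Subset m)
subsets zero    = [ Vec.[] ]
subsets (suc m) =
  map (outside Vec.∷_) (subsets m) ++ map (inside Vec.∷_) (subsets m)

-- The empty sub-family is t-intersecting, so the default 0 is harmless.
l : ∀ {m n} → Family m n → ℕ → ℕ
l {m} F t = max 0 (map ∣_∣ (filter (intersecting? F t) (subsets m)))

_⁺[_,_] : ∀ {m n} → Subset m → Family m n → ℕ → Subset m
𝒜 ⁺[ F , t ] =
  Vec.tabulate λ a → does ((a ∈? 𝒜) ×-dec intersectsOthers? F t 𝒜 a)

_⁻[_,_] : ∀ {m n} → Subset m → Family m n → ℕ → Subset m
𝒜 ⁻[ F , t ] = 𝒜 ─ 𝒜 ⁺[ F , t ]

-- The case split is on the cardinality of 𝒜 ⁻[ F , t ], which is 0 exactly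
-- when that sub-family is empty.
β-of : ∀ {m n} .{{_ : NonZero m}} → Family m n → ℕ → Subset m → ℚ
β-of {m} F t 𝒜 with ∣ 𝒜 ⁻[ F , t ] ∣
... | zero  = + l F t / m
... | suc d = (+ l F t ℤ.- + ∣ 𝒜 ⁺[ F , t ] ∣) / suc d

-- The default is the value at the empty sub-family, so this is the minimum
-- over all sub-families.
β : ∀ {m n} .{{_ : NonZero m}} → Family m n → ℕ → ℚ
β {m} F t = minℚ (β-of F t ∅) (map (β-of F t) (subsets m))

Σ∣_∣ : ∀ {m k} → (Fin k → Subset m) → ℕ
Σ∣ 𝒜 ∣ = ℕ.sum (List.tabulate λ i → ∣ 𝒜 i ∣)

Π∣_∣ : ∀ {m k} → (Fin k → Subset m) → ℕ
Π∣ 𝒜 ∣ = ℕ.product (List.tabulate λ i → ∣ 𝒜 i ∣)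

-- Positivity of β, needed to form its reciprocal.

∈-subsets : ∀ {m} (p : Subset m) → p ∈ˡ subsets m
∈-subsets Vec.[]              = here refl
∈-subsets (outside Vec.∷ p) = ∈-++⁺ˡ (∈-map⁺ _ (∈-subsets p))
∈-subsets {suc m} (inside Vec.∷ p) =
  ∈-++⁺ʳ (map (outside Vec.∷_) (subsets m)) (∈-map⁺ _ (∈-subsets p))

∣∣≤l : ∀ {m n} (F : Family m n) t 𝒜 → Intersecting F t 𝒜 → ∣ 𝒜 ∣ ≤ l F t
∣∣≤l F t 𝒜 int = All.lookup (xs≤max 0 _)
  (∈-map⁺ ∣_∣ (∈-filter⁺ (intersecting? F t) (∈-subsets 𝒜) int))

∈⁺⇒ : ∀ {m n} (F : Family m n) t 𝒜 {a} →
      a ∈ 𝒜 ⁺[ F , t ] → a ∈ 𝒜 × IntersectsOthers F t 𝒜 a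
∈⁺⇒ F t 𝒜 {a} a∈ = does⁻ (P? a)
  (trans (sym (lookup∘tabulate (λ c → does (P? c)) a)) ([]=⇒lookup a∈))
  where
  P? : ∀ c → Dec (c ∈ 𝒜 × IntersectsOthers F t 𝒜 c)
  P? c = (c ∈? 𝒜) ×-dec intersectsOthers? F t 𝒜 c

  does⁻ : ∀ {P : Set} (P? : Dec P) → does P? ≡ true → P
  does⁻ (yes p) _ = p

∈⁻⇒∈ : ∀ {m n} (F : Family m n) t 𝒜 {a} → a ∈ 𝒜 ⁻[ F , t ] → a ∈ 𝒜
∈⁻⇒∈ F t 𝒜 = p─q⊆p 𝒜 (𝒜 ⁺[ F , t ])

∈─⇒∉ : ∀ {m} (p q : Subset m) {a} → a ∈ p ─ q → a ∉ q
∈─⇒∉ (_ Vec.∷ _) (inside Vec.∷ _) () Vec.here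
∈─⇒∉ (_ Vec.∷ p) (_ Vec.∷ q) (Vec.there a∈) (Vec.there a∈q) = ∈─⇒∉ p q a∈ a∈q

0<∣∣⇒Nonempty : ∀ {m} (p : Subset m) → 0 < ∣ p ∣ → Nonempty p
0<∣∣⇒Nonempty {m} p 0<p with nonempty? p
... | yes ne = ne
... | no  em = contradiction
  (trans (cong ∣_∣ (Empty-unique em)) (∣⊥∣≡0 m)) (ℕ.>⇒≢ 0<p)

∣⁺∣<l : ∀ {m n} (F : Family m n) t 𝒜 →
        0 < ∣ 𝒜 ⁻[ F , t ] ∣ → ∣ 𝒜 ⁺[ F , t ] ∣ < l F t
∣⁺∣<l F t 𝒜 0<∣𝒜⁻∣ = ℕ.<-≤-trans
  (p⊂q⇒∣p∣<∣q∣ (p⊆p∪q ⁅ b ⁆ , b , q⊆p∪q 𝒜⁺ ⁅ b ⁆ (x∈⁅x⁆ b) , ∈─⇒∉ 𝒜 𝒜⁺ b∈𝒜⁻))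
  (∣∣≤l F t (𝒜⁺ ∪ ⁅ b ⁆) int)
  where
  𝒜⁺ = 𝒜 ⁺[ F , t ]
  ne = 0<∣∣⇒Nonempty (𝒜 ⁻[ F , t ]) 0<∣𝒜⁻∣
  b = proj₁ ne
  b∈𝒜⁻ = proj₂ ne
  b∈𝒜 = ∈⁻⇒∈ F t 𝒜 b∈𝒜⁻

  ∪⇒∈ : ∀ {c} → c ∈ 𝒜⁺ ∪ ⁅ b ⁆ → c ∈ 𝒜
  ∪⇒∈ c∈ with x∈p∪q⁻ 𝒜⁺ ⁅ b ⁆ c∈
  ... | inj₁ c∈𝒜⁺ = proj₁ (∈⁺⇒ F t 𝒜 c∈𝒜⁺)
  ... | inj₂ c∈b  = subst (_∈ 𝒜) (sym (x∈⁅y⁆⇒x≡y b c∈b)) b∈𝒜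

  int : Intersecting F t (𝒜⁺ ∪ ⁅ b ⁆)
  int c c∈ d d∈ d≢c with x∈p∪q⁻ 𝒜⁺ ⁅ b ⁆ c∈ | x∈p∪q⁻ 𝒜⁺ ⁅ b ⁆ d∈
  ... | inj₁ c∈𝒜⁺ | _         = proj₂ (∈⁺⇒ F t 𝒜 c∈𝒜⁺) d (∪⇒∈ d∈) d≢c
  ... | inj₂ _    | inj₁ d∈𝒜⁺ =
    subst (λ s → t ≤ ∣ s ∣) (∩-comm (member F d) (member F c))
      (proj₂ (∈⁺⇒ F t 𝒜 d∈𝒜⁺) c (∪⇒∈ c∈) λ c≡d → d≢c (sym c≡d))
  ... | inj₂ c∈b  | inj₂ d∈b  =
    contradiction (trans (x∈⁅y⁆⇒x≡y b d∈b) (sym (x∈⁅y⁆⇒x≡y b c∈b))) d≢c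

0<l : ∀ {m n} .{{_ : NonZero m}} (F : Family m n) t → 0 < l F t
0<l {suc m} F t = subst (_≤ l F t) (∣⁅x⁆∣≡1 {suc m} zero) (∣∣≤l F t ⁅ zero ⁆
  λ a a∈ b b∈ b≢a →
    contradiction (trans (x∈⁅y⁆⇒x≡y zero b∈) (sym (x∈⁅y⁆⇒x≡y zero a∈))) b≢a)

/-positive : ∀ p d .{{_ : NonZero d}} → 0 < p → Positive (+ p / d)
/-positive p d {{d≢0}} 0<p = ℚ.normalize-pos p d {{d≢0}} {{>-nonZero 0<p}}

β-of-positive : ∀ {m n} .{{_ : NonZero m}} (F : Family m n) t 𝒜 → Positive (β-of F t 𝒜)
β-of-positive {m} F t 𝒜 with ∣ 𝒜 ⁻[ F , t ] ∣ in eq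
... | zero  = /-positive (l F t) m (0<l F t)
... | suc d = subst (λ z → Positive (z / suc d)) {x = + (l F t ∸ ∣ 𝒜 ⁺[ F , t ] ∣)}
    (trans (sym (ℤ.⊖-≥ (ℕ.<⇒≤ ∣𝒜⁺∣<l))) (sym (ℤ.m-n≡m⊖n (l F t) ∣ 𝒜 ⁺[ F , t ] ∣)))
    (/-positive (l F t ∸ ∣ 𝒜 ⁺[ F , t ] ∣) (suc d) (ℕ.m<n⇒0<n∸m ∣𝒜⁺∣<l))
  where
  ∣𝒜⁺∣<l = ∣⁺∣<l F t 𝒜 (subst (0 <_) (sym eq) z<s)

β-positive : ∀ {m n} .{{_ : NonZero m}} (F : Family m n) t → Positive (β F t)
β-positive {m} F t = argmin-all id {P = Positive} (β-of-positive F t ∅)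
  (All.map⁺ (All.universal (β-of-positive F t) (subsets m)))

κ : ∀ {m n} .{{_ : NonZero m}} → Family m n → ℕ → ℚ
κ F t = 1/_ (β F t) {{ℚ.pos⇒nonZero (β F t) {{β-positive F t}}}}

{-# OPTIONS --safe #-}
-- Let 𝒰 be the union of the 𝒜 i.  A member of 𝒰 lying in two different 𝒜 i
-- t-intersects every other member of 𝒰, so the parts of the 𝒜 i outside 𝒰⁺ are
-- pairwise disjoint and Σ ∣𝒜 i∣ ≤ k ∣𝒰⁺∣ + ∣𝒰⁻∣.  If 𝒰⁻ is non-empty, then
-- k ≥ κ gives ∣𝒰⁻∣ ≤ k (l − ∣𝒰⁺∣), strictly if k > κ.  If 𝒰⁻ is empty, then 𝒰
-- is t-intersecting, and equality forces every 𝒜 i to be 𝒰.  The product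
-- bound follows from the sum bound by a form of the AM–GM inequality.
module Submission where

open import Defs
open import Data.Fin.Base using (Fin; zero; suc; fromℕ<)
import Data.Fin.Properties as Fin
open import Data.Fin.Subset
  using (Subset; inside; outside; _∈_; _⊆_; _∩_; _─_; ∣_∣; ⁅_⁆; ⋃)
  renaming (⊥ to ∅)
open import Data.Fin.Subset.Properties
  using (_∈?_; x∈p∩q⁺; ∣p∩q∣≤∣p∣; ∣p∩q∣≤∣q∣; ∩-idem; p⊆q⇒∣p∣≤∣q∣; p⊂q⇒∣p∣<∣q∣;
         ⊆-antisym; ∣⁅x⁆∣≡1; x∈⁅x⁆; x∈⁅y⁆⇒x≡y; p─q⊆p; x∈p∧x∉q⇒x∈p─q;
         x∈p∪q⁻; p⊆p∪q; q⊆p∪q; ∉⊥)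
open import Data.Integer.Base as ℤ using (+_)
import Data.Integer.Properties as ℤ
open import Data.List.Base using (tabulate; map; filter; allFin)
open import Data.List.Extrema.Nat using (argmax-sel)
open import Data.List.Membership.Propositional.Properties
  using (∈-map⁺; ∈-map⁻; ∈-filter⁻)
import Data.List.Relation.Unary.All as All
open import Data.Nat.Base
  using (ℕ; zero; suc; _+_; _∸_; _≤_; _<_; _*_; _^_; NonZero; >-nonZero; z≤n)
open import Data.Nat.ListAction using (sum; product)
open import Data.Nat.Properties as ℕ using (module ≤-Reasoning)
open import Data.Nat.Tactic.RingSolver using (solve-∀)
open import Data.Product.Base using (_×_; ∃-syntax; _,_; proj₂)
open import Data.Rational.Base as ℚ using (_/_; 1ℚ) renaming (_≤_ to _≤ℚ_; _<_ to _<ℚ_)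
import Data.Rational.Properties as ℚ
open import Relation.Binary.Bundles using (DecTotalOrder)
open import Data.List.Extrema (DecTotalOrder.totalOrder ℚ.≤-decTotalOrder) using (min≤xs)
import Data.Rational.Unnormalised.Base as ℚᵘ
import Data.Rational.Unnormalised.Properties as ℚᵘ
open import Data.Sum.Base using (inj₁; inj₂)
import Data.Vec.Base as Vec
open import Data.Vec.Properties using (lookup∘tabulate; lookup⇒[]=)
open import Function.Base using (id; _∘_)
open import Relation.Binary.PropositionalEquality
  using (_≡_; _≢_; refl; sym; trans; cong; cong₂; subst; subst₂; module ≡-Reasoning)
open import Relation.Nullary using (yes; no; contradiction)
open import Relation.Nullary.Decidable using (_×-dec_; dec-true)

-- Sums and products over Fin k

sum-const : ∀ k (f : Fin k → ℕ) {c} → (∀ i → f i ≡ c) → sum (tabulate f) ≡ k * c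
sum-const zero    f f≡c = refl
sum-const (suc k) f f≡c = cong₂ _+_ (f≡c zero) (sum-const k (f ∘ suc) (f≡c ∘ suc))

product-const : ∀ k (f : Fin k → ℕ) {c} → (∀ i → f i ≡ c) → product (tabulate f) ≡ c ^ k
product-const zero    f f≡c = refl
product-const (suc k) f f≡c = cong₂ _*_ (f≡c zero) (product-const k (f ∘ suc) (f≡c ∘ suc))

sum-≤-const : ∀ k (f : Fin k → ℕ) {c} → (∀ i → f i ≤ c) → sum (tabulate f) ≤ k * c
sum-≤-const zero    f f≤c = z≤n
sum-≤-const (suc k) f f≤c = ℕ.+-mono-≤ (f≤c zero) (sum-≤-const k (f ∘ suc) (f≤c ∘ suc))

sum-≤-const+ : ∀ k (f g : Fin k → ℕ) {c} → (∀ i → f i ≤ c + g i) →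
               sum (tabulate f) ≤ k * c + sum (tabulate g)
sum-≤-const+ zero    f g     f≤ = z≤n
sum-≤-const+ (suc k) f g {c} f≤ = begin
  f zero + sum (tabulate (f ∘ suc))
    ≤⟨ ℕ.+-mono-≤ (f≤ zero) (sum-≤-const+ k (f ∘ suc) (g ∘ suc) (f≤ ∘ suc)) ⟩
  (c + g zero) + (k * c + sum (tabulate (g ∘ suc)))
    ≡⟨ interchange c (g zero) (k * c) (sum (tabulate (g ∘ suc))) ⟩
  (c + k * c) + (g zero + sum (tabulate (g ∘ suc))) ∎
  where
  open ≤-Reasoning
  interchange : ∀ a b c d → (a + b) + (c + d) ≡ (a + c) + (b + d)
  interchange = solve-∀

-- No term can exceed `c`, so no term can make up for another that falls short of it.
sum-maximal⇒const : ∀ k (f : Fin k → ℕ) {c} → (∀ i → f i ≤ c) →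
                    sum (tabulate f) ≡ k * c → ∀ i → f i ≡ c
sum-maximal⇒const (suc k) f {c} f≤c eq zero = ℕ.≤-antisym (f≤c zero)
  (ℕ.+-cancelʳ-≤ (k * c) c (f zero) (begin
    c + k * c                          ≡⟨ eq ⟨
    f zero + sum (tabulate (f ∘ suc))  ≤⟨ ℕ.+-monoʳ-≤ (f zero) (sum-≤-const k (f ∘ suc) (f≤c ∘ suc)) ⟩
    f zero + k * c                     ∎))
  where open ≤-Reasoning
sum-maximal⇒const (suc k) f {c} f≤c eq (suc i) =
  sum-maximal⇒const k (f ∘ suc) (f≤c ∘ suc)
    (ℕ.≤-antisym (sum-≤-const k (f ∘ suc) (f≤c ∘ suc))
      (ℕ.+-cancelˡ-≤ c (k * c) _ (begin
        c + k * c                          ≡⟨ eq ⟨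
        f zero + sum (tabulate (f ∘ suc))  ≤⟨ ℕ.+-monoˡ-≤ _ (f≤c zero) ⟩
        c + sum (tabulate (f ∘ suc))       ∎)))
    i
  where open ≤-Reasoning

-- AM–GM over the naturals

-- This is a / l ≤ (1 + 1/l) ^ (a − l) without denominators; multiplied over all
-- factors it gives AM–GM.
below-exponential : ∀ l a → a * l ^ a * suc l ^ l ≤ l * l ^ l * suc l ^ a
-- Both sides agree at `a = l`; each case is an induction on the distance from `a` to `l`.
below-exponential l a with ℕ.≤-total l a
... | inj₁ l≤a = subst (λ b → b * l ^ b * suc l ^ l ≤ l * l ^ l * suc l ^ b)
                   (ℕ.m∸n+n≡m l≤a) (above (a ∸ l))
  where
  open ≤-Reasoning
  above : ∀ e → (e + l) * l ^ (e + l) * suc l ^ l ≤ l * l ^ l * suc l ^ (e + l)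
  above zero    = ℕ.≤-refl
  -- Raising `b` by one multiplies the right side by `suc l`, and the left side grows by no more,
  -- since `suc b * l ≤ b * suc l` for `l ≤ b`.
  above (suc e) = begin
    suc b * (l * x) * y      ≡⟨ lhs b l x y ⟩
    (l + b * l) * (x * y)    ≤⟨ ℕ.*-monoˡ-≤ (x * y) (ℕ.+-monoˡ-≤ (b * l) (ℕ.m≤n+m l e)) ⟩
    (b + b * l) * (x * y)    ≡⟨ mid b l x y ⟩
    suc l * (b * x * y)      ≤⟨ ℕ.*-monoʳ-≤ (suc l) (above e) ⟩
    suc l * (l * l ^ l * z)  ≡⟨ rhs l (l ^ l) z ⟩
    l * l ^ l * (suc l * z)  ∎
    where
    b = e + l
    x = l ^ b
    y = suc l ^ l
    z = suc l ^ b
    lhs : ∀ b l x y → suc b * (l * x) * y ≡ (l + b * l) * (x * y)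
    lhs = solve-∀
    mid : ∀ b l x y → (b + b * l) * (x * y) ≡ suc l * (b * x * y)
    mid = solve-∀
    rhs : ∀ l w z → suc l * (l * w * z) ≡ l * w * (suc l * z)
    rhs = solve-∀
... | inj₂ a≤l = below (l ∸ a) a (ℕ.m∸n+n≡m a≤l)
  where
  open ≤-Reasoning
  below : ∀ e b → e + b ≡ l → b * l ^ b * suc l ^ l ≤ l * l ^ l * suc l ^ b
  below zero    b refl = ℕ.≤-refl
  -- Going down from `suc b` to `b`, the right side loses a factor `suc l`, which is cancelled; now
  -- `b * suc l ≤ suc b * l`, since `b ≤ l`.
  below (suc e) b e+b≡l = ℕ.*-cancelˡ-≤ (suc l) (begin
    suc l * (b * x * y)      ≡⟨ lhs b l x y ⟩
    (b + b * l) * (x * y)    ≤⟨ ℕ.*-monoˡ-≤ (x * y) (ℕ.+-monoˡ-≤ (b * l) b≤l) ⟩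
    (l + b * l) * (x * y)    ≡⟨ mid b l x y ⟩
    suc b * (l * x) * y      ≤⟨ below e (suc b) (trans (ℕ.+-suc e b) e+b≡l) ⟩
    l * l ^ l * (suc l * z)  ≡⟨ rhs l (l ^ l) z ⟩
    suc l * (l * l ^ l * z)  ∎)
    where
    b≤l : b ≤ l
    b≤l = subst (b ≤_) e+b≡l (ℕ.m≤n+m b (suc e))
    x = l ^ b
    y = suc l ^ l
    z = suc l ^ b
    lhs : ∀ b l x y → suc l * (b * x * y) ≡ (b + b * l) * (x * y)
    lhs = solve-∀
    mid : ∀ b l x y → (l + b * l) * (x * y) ≡ suc b * (l * x) * y
    mid = solve-∀
    rhs : ∀ l w z → l * w * (suc l * z) ≡ suc l * (l * w * z)
    rhs = solve-∀

product-below-exponential : ∀ l k (f : Fin k → ℕ) →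
  let S = sum (tabulate f) in
  product (tabulate f) * l ^ S * suc l ^ (k * l) ≤ l ^ k * l ^ (k * l) * suc l ^ S
product-below-exponential l zero    f = ℕ.≤-refl
product-below-exponential l (suc k) f = begin
  a * P * l ^ (a + S) * M ^ (l + k * l)
    ≡⟨ cong₂ (λ u v → a * P * u * v) (ℕ.^-distribˡ-+-* l a S) (ℕ.^-distribˡ-+-* M l (k * l)) ⟩
  a * P * (l ^ a * l ^ S) * (M ^ l * M ^ (k * l))
    ≡⟨ shuffle a P (l ^ a) (l ^ S) (M ^ l) (M ^ (k * l)) ⟩
  (a * l ^ a * M ^ l) * (P * l ^ S * M ^ (k * l))
    ≤⟨ ℕ.*-mono-≤ (below-exponential l a) (product-below-exponential l k (f ∘ suc)) ⟩
  (l * l ^ l * M ^ a) * (l ^ k * l ^ (k * l) * M ^ S)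
    ≡⟨ shuffle l (l ^ k) (l ^ l) (l ^ (k * l)) (M ^ a) (M ^ S) ⟨
  l * l ^ k * (l ^ l * l ^ (k * l)) * (M ^ a * M ^ S)
    ≡⟨ cong₂ (λ u v → l * l ^ k * u * v) (ℕ.^-distribˡ-+-* l l (k * l)) (ℕ.^-distribˡ-+-* M a S) ⟨
  l * l ^ k * l ^ (l + k * l) * M ^ (a + S) ∎
  where
  open ≤-Reasoning
  M = suc l
  a = f zero
  P = product (tabulate (f ∘ suc))
  S = sum (tabulate (f ∘ suc))
  shuffle : ∀ a b c d e f → a * b * (c * d) * (e * f) ≡ (a * c * e) * (b * d * f)
  shuffle = solve-∀

-- Splitting `k * l` as `S + d` and cancelling `l ^ S * suc l ^ S` leaves P ≤ l^k (l / (l + 1))^d: a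
-- sum that is `d` short of `k * l` costs the product `d` factors l / (l + 1).
product-deficit : ∀ l .{{_ : NonZero l}} k (f : Fin k → ℕ) d → sum (tabulate f) + d ≡ k * l →
                  product (tabulate f) * suc l ^ d ≤ l ^ k * l ^ d
product-deficit l k f d S+d≡kl =
  ℕ.*-cancelʳ-≤ (P * M ^ d) (l ^ k * l ^ d) (l ^ S * M ^ S) {{nz}} (begin
    P * M ^ d * (l ^ S * M ^ S)      ≡⟨ lhs P (M ^ d) (l ^ S) (M ^ S) ⟩
    P * l ^ S * (M ^ S * M ^ d)      ≡⟨ cong (P * l ^ S *_) (ℕ.^-distribˡ-+-* M S d) ⟨
    P * l ^ S * M ^ (S + d)          ≡⟨ cong (λ e → P * l ^ S * M ^ e) S+d≡kl ⟩
    P * l ^ S * M ^ (k * l)          ≤⟨ product-below-exponential l k f ⟩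
    l ^ k * l ^ (k * l) * M ^ S      ≡⟨ cong (λ e → l ^ k * l ^ e * M ^ S) S+d≡kl ⟨
    l ^ k * l ^ (S + d) * M ^ S      ≡⟨ cong (λ u → l ^ k * u * M ^ S) (ℕ.^-distribˡ-+-* l S d) ⟩
    l ^ k * (l ^ S * l ^ d) * M ^ S  ≡⟨ rhs (l ^ k) (l ^ S) (l ^ d) (M ^ S) ⟩
    l ^ k * l ^ d * (l ^ S * M ^ S)  ∎)
  where
  open ≤-Reasoning
  M = suc l
  P = product (tabulate f)
  S = sum (tabulate f)
  nz : NonZero (l ^ S * M ^ S)
  nz = ℕ.m*n≢0 (l ^ S) (M ^ S) {{ℕ.m^n≢0 l S}} {{ℕ.m^n≢0 M S}}
  lhs : ∀ a b c d → a * b * (c * d) ≡ a * c * (d * b)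
  lhs = solve-∀
  rhs : ∀ a b c d → a * (b * c) * d ≡ a * c * (b * d)
  rhs = solve-∀

sum≤⇒product≤ : ∀ l .{{_ : NonZero l}} k (f : Fin k → ℕ) →
                sum (tabulate f) ≤ k * l → product (tabulate f) ≤ l ^ k
sum≤⇒product≤ l k f S≤kl =
  ℕ.*-cancelʳ-≤ P (l ^ k) (l ^ d) {{ℕ.m^n≢0 l d}}
    -- Weakening `suc l ^ d` to `l ^ d` lets the common factor cancel.
    (ℕ.≤-trans (ℕ.*-monoʳ-≤ P (ℕ.^-monoˡ-≤ d (ℕ.n≤1+n l)))
      (product-deficit l k f d (ℕ.m+[n∸m]≡n S≤kl)))
  where
  P = product (tabulate f)
  d = k * l ∸ sum (tabulate f)

sum<⇒product< : ∀ l .{{_ : NonZero l}} k (f : Fin k → ℕ) →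
                sum (tabulate f) < k * l → product (tabulate f) < l ^ k
sum<⇒product< l k f S<kl =
  ℕ.*-cancelʳ-< (suc l ^ d) (product (tabulate f)) (l ^ k)
    (ℕ.≤-<-trans (product-deficit l k f d (ℕ.m+[n∸m]≡n (ℕ.<⇒≤ S<kl)))
      (ℕ.*-monoʳ-< (l ^ k) {{ℕ.m^n≢0 l k}}
        -- The deficit `d` is positive, so `l ^ d < suc l ^ d`; this is the source of strictness.
        (ℕ.^-monoˡ-< d {{>-nonZero (ℕ.m<n⇒0<n∸m S<kl)}} (ℕ.n<1+n l))))
  where
  d = k * l ∸ sum (tabulate f)

-- Subsets of a finite set

∣p∩q∣+∣p─q∣≡∣p∣ : ∀ {m} (p q : Subset m) → ∣ p ∩ q ∣ + ∣ p ─ q ∣ ≡ ∣ p ∣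
∣p∩q∣+∣p─q∣≡∣p∣ Vec.[]              Vec.[]              = refl
∣p∩q∣+∣p─q∣≡∣p∣ (outside Vec.∷ p) (outside Vec.∷ q) = ∣p∩q∣+∣p─q∣≡∣p∣ p q
∣p∩q∣+∣p─q∣≡∣p∣ (outside Vec.∷ p) (inside  Vec.∷ q) = ∣p∩q∣+∣p─q∣≡∣p∣ p q
∣p∩q∣+∣p─q∣≡∣p∣ (inside  Vec.∷ p) (outside Vec.∷ q) =
  trans (ℕ.+-suc ∣ p ∩ q ∣ ∣ p ─ q ∣) (cong suc (∣p∩q∣+∣p─q∣≡∣p∣ p q))
∣p∩q∣+∣p─q∣≡∣p∣ (inside  Vec.∷ p) (inside  Vec.∷ q) = cong suc (∣p∩q∣+∣p─q∣≡∣p∣ p q)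

∣p∣≤∣q∣+∣p─q∣ : ∀ {m} (p q : Subset m) → ∣ p ∣ ≤ ∣ q ∣ + ∣ p ─ q ∣
∣p∣≤∣q∣+∣p─q∣ p q = subst (_≤ ∣ q ∣ + ∣ p ─ q ∣) (∣p∩q∣+∣p─q∣≡∣p∣ p q)
  (ℕ.+-monoˡ-≤ ∣ p ─ q ∣ (∣p∩q∣≤∣q∣ p q))

p⊆q∧∣q∣≤∣p∣⇒p≡q : ∀ {m} {p q : Subset m} → p ⊆ q → ∣ q ∣ ≤ ∣ p ∣ → p ≡ q
p⊆q∧∣q∣≤∣p∣⇒p≡q {p = p} {q} p⊆q ∣q∣≤∣p∣ = ⊆-antisym p⊆q q⊆p
  where
  q⊆p : q ⊆ p
  q⊆p {x} x∈q with x ∈? p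
  ... | yes x∈p = x∈p
  ... | no  x∉p = contradiction ∣q∣≤∣p∣ (ℕ.<⇒≱ (p⊂q⇒∣p∣<∣q∣ (p⊆q , x , x∈q , x∉p)))

-- Once `B zero` is removed from `p`, disjointness keeps the remaining sets inside `p ─ B zero`, and
-- induction applies there.
Σ∣disjoint∣≤ : ∀ {m} k (B : Fin k → Subset m) p → (∀ i → B i ⊆ p) →
               (∀ i j {x} → x ∈ B i → x ∈ B j → i ≡ j) → Σ∣ B ∣ ≤ ∣ p ∣
Σ∣disjoint∣≤ zero    B p B⊆p disj = z≤n
Σ∣disjoint∣≤ (suc k) B p B⊆p disj = begin
  ∣ B zero ∣ + Σ∣ B ∘ suc ∣
    ≤⟨ ℕ.+-mono-≤ (p⊆q⇒∣p∣≤∣q∣ λ x∈ → x∈p∩q⁺ (B⊆p zero x∈ , x∈))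
         (Σ∣disjoint∣≤ k (B ∘ suc) (p ─ B zero)
           (λ i x∈ → x∈p∧x∉q⇒x∈p─q (B⊆p (suc i) x∈)
             λ x∈₀ → contradiction (disj zero (suc i) x∈₀ x∈) λ ())
           (λ i j x∈i x∈j → Fin.suc-injective (disj (suc i) (suc j) x∈i x∈j))) ⟩
  ∣ p ∩ B zero ∣ + ∣ p ─ B zero ∣  ≡⟨ ∣p∩q∣+∣p─q∣≡∣p∣ p (B zero) ⟩
  ∣ p ∣ ∎
  where open ≤-Reasoning

∈-⋃⁺ : ∀ {m} k (𝒜 : Fin k → Subset m) i → 𝒜 i ⊆ ⋃ (tabulate 𝒜)
∈-⋃⁺ (suc k) 𝒜 zero    x∈ = p⊆p∪q _ x∈
∈-⋃⁺ (suc k) 𝒜 (suc i) x∈ = q⊆p∪q (𝒜 zero) _ (∈-⋃⁺ k (𝒜 ∘ suc) i x∈)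

∈-⋃⁻ : ∀ {m} k (𝒜 : Fin k → Subset m) {x} → x ∈ ⋃ (tabulate 𝒜) → ∃[ i ] x ∈ 𝒜 i
∈-⋃⁻ zero    𝒜 x∈ = contradiction x∈ ∉⊥
∈-⋃⁻ (suc k) 𝒜 x∈ with x∈p∪q⁻ (𝒜 zero) _ x∈
... | inj₁ x∈₀ = zero , x∈₀
... | inj₂ x∈⋃ with i , x∈ᵢ ← ∈-⋃⁻ k (𝒜 ∘ suc) x∈⋃ = suc i , x∈ᵢ

-- The ratios β and κ

-- Fractions in `ℚ` are reduced, which hides numerator and denominator. In the unnormalised
-- rationals both are explicit, so comparison with 1 becomes an integer inequality by
-- cross-multiplication.
toℚᵘ-/* : ∀ q d k → ℚ.toℚᵘ ((+ q / suc d) ℚ.* (+ k / 1)) ℚᵘ.≃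
                    ℚᵘ.mkℚᵘ (+ q) d ℚᵘ.* ℚᵘ.mkℚᵘ (+ k) 0
toℚᵘ-/* q d k = ℚᵘ.≃-trans (ℚ.toℚᵘ-homo-* (+ q / suc d) (+ k / 1))
  (ℚᵘ.*-cong (ℚ.toℚᵘ-fromℚᵘ (ℚᵘ.mkℚᵘ (+ q) d)) (ℚ.toℚᵘ-fromℚᵘ (ℚᵘ.mkℚᵘ (+ k) 0)))

1*↧≡ : ∀ d → ℤ.1ℤ ℤ.* + (suc d * 1) ≡ + suc d
1*↧≡ d = trans (ℤ.*-identityˡ _) (cong +_ (ℕ.*-identityʳ (suc d)))

↥*1≡ : ∀ q k → (+ q ℤ.* + k) ℤ.* ℤ.1ℤ ≡ + (q * k)
↥*1≡ q k = trans (ℤ.*-identityʳ _) (sym (ℤ.pos-* q k))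

1≤/*⇒ : ∀ q d k → 1ℚ ≤ℚ (+ q / suc d) ℚ.* (+ k / 1) → suc d ≤ q * k
1≤/*⇒ q d k 1≤ = ℤ.drop‿+≤+ (subst₂ ℤ._≤_ (1*↧≡ d) (↥*1≡ q k)
  (ℚᵘ.drop-*≤* (ℚᵘ.≤-respʳ-≃ (toℚᵘ-/* q d k) (ℚ.toℚᵘ-mono-≤ 1≤))))

1</*⇒ : ∀ q d k → 1ℚ <ℚ (+ q / suc d) ℚ.* (+ k / 1) → suc d < q * k
1</*⇒ q d k 1< = ℤ.drop‿+<+ (subst₂ ℤ._<_ (1*↧≡ d) (↥*1≡ q k)
  (ℚᵘ.drop-*<* (ℚᵘ.<-respʳ-≃ (toℚᵘ-/* q d k) (ℚ.toℚᵘ-mono-< 1<))))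

+-+≡+∸ : ∀ {p l} → p ≤ l → + l ℤ.- + p ≡ + (l ∸ p)
+-+≡+∸ {p} {l} p≤l = trans (ℤ.m-n≡m⊖n l p) (ℤ.⊖-≥ p≤l)

k*p+[l∸p]*k≡k*l : ∀ k {p l} → p ≤ l → k * p + (l ∸ p) * k ≡ k * l
k*p+[l∸p]*k≡k*l k {p} {l} p≤l = begin
  k * p + (l ∸ p) * k  ≡⟨ factor k p (l ∸ p) ⟩
  k * (p + (l ∸ p))    ≡⟨ cong (k *_) (ℕ.m+[n∸m]≡n p≤l) ⟩
  k * l                ∎
  where
  open ≡-Reasoning
  factor : ∀ k p e → k * p + e * k ≡ k * (p + e)
  factor = solve-∀

module _ {m n} .{{_ : NonZero m}} (F : Family m n) (t : ℕ) where

  1≤β-of*k⇒ : ∀ k 𝒜 → 0 < ∣ 𝒜 ⁻[ F , t ] ∣ → 1ℚ ≤ℚ β-of F t 𝒜 ℚ.* (+ k / 1) →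
              k * ∣ 𝒜 ⁺[ F , t ] ∣ + ∣ 𝒜 ⁻[ F , t ] ∣ ≤ k * l F t
  -- Abstracting `∣ 𝒜 ⁻[ F , t ] ∣` makes `β-of` reduce to its `suc d` branch, and `∣⁺∣<l` turns the
  -- integer difference there into a natural number.
  1≤β-of*k⇒ k 𝒜 0<∣𝒜⁻∣ 1≤ with ∣ 𝒜 ⁻[ F , t ] ∣ | 0<∣𝒜⁻∣ | ∣⁺∣<l F t 𝒜 0<∣𝒜⁻∣
  ... | suc d | _ | ∣𝒜⁺∣<l =
    subst (k * p + suc d ≤_) (k*p+[l∸p]*k≡k*l k (ℕ.<⇒≤ ∣𝒜⁺∣<l))
      (ℕ.+-monoʳ-≤ (k * p) (1≤/*⇒ (l F t ∸ p) d k
        (subst (λ z → 1ℚ ≤ℚ (z / suc d) ℚ.* (+ k / 1)) (+-+≡+∸ (ℕ.<⇒≤ ∣𝒜⁺∣<l)) 1≤)))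
    where p = ∣ 𝒜 ⁺[ F , t ] ∣

  1<β-of*k⇒ : ∀ k 𝒜 → 0 < ∣ 𝒜 ⁻[ F , t ] ∣ → 1ℚ <ℚ β-of F t 𝒜 ℚ.* (+ k / 1) →
              k * ∣ 𝒜 ⁺[ F , t ] ∣ + ∣ 𝒜 ⁻[ F , t ] ∣ < k * l F t
  1<β-of*k⇒ k 𝒜 0<∣𝒜⁻∣ 1< with ∣ 𝒜 ⁻[ F , t ] ∣ | 0<∣𝒜⁻∣ | ∣⁺∣<l F t 𝒜 0<∣𝒜⁻∣
  ... | suc d | _ | ∣𝒜⁺∣<l =
    subst (k * p + suc d <_) (k*p+[l∸p]*k≡k*l k (ℕ.<⇒≤ ∣𝒜⁺∣<l))
      (ℕ.+-monoʳ-< (k * p) (1</*⇒ (l F t ∸ p) d k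
        (subst (λ z → 1ℚ <ℚ (z / suc d) ℚ.* (+ k / 1)) (+-+≡+∸ (ℕ.<⇒≤ ∣𝒜⁺∣<l)) 1<)))
    where p = ∣ 𝒜 ⁺[ F , t ] ∣

  private
    β-nonZero : ℚ.NonZero (β F t)
    β-nonZero = ℚ.pos⇒nonZero (β F t) {{β-positive F t}}

    β-nonNegative : ℚ.NonNegative (β F t)
    β-nonNegative = ℚ.pos⇒nonNeg (β F t) {{β-positive F t}}

  β*κ≡1 : β F t ℚ.* κ F t ≡ 1ℚ
  β*κ≡1 = ℚ.*-inverseʳ (β F t) {{β-nonZero}}

  β*k≤β-of*k : ∀ k 𝒜 → β F t ℚ.* (+ k / 1) ≤ℚ β-of F t 𝒜 ℚ.* (+ k / 1)
  β*k≤β-of*k k 𝒜 = ℚ.*-monoʳ-≤-nonNeg (+ k / 1) {{ℚ.normalize-nonNeg k 1}}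
    (All.lookup (min≤xs (β-of F t ∅) _) (∈-map⁺ (β-of F t) (∈-subsets 𝒜)))

  -- The chain is 1 = β κ ≤ β k ≤ β(𝒜) k, where β(𝒜) is the ratio for `𝒜`; its denominator
  -- `∣ 𝒜 ⁻[ F , t ] ∣` is then cleared.
  κ≤k⇒ : ∀ k 𝒜 → κ F t ≤ℚ + k / 1 → 0 < ∣ 𝒜 ⁻[ F , t ] ∣ →
         k * ∣ 𝒜 ⁺[ F , t ] ∣ + ∣ 𝒜 ⁻[ F , t ] ∣ ≤ k * l F t
  κ≤k⇒ k 𝒜 κ≤k 0<∣𝒜⁻∣ = 1≤β-of*k⇒ k 𝒜 0<∣𝒜⁻∣ (ℚ.≤-trans
    (subst (_≤ℚ β F t ℚ.* (+ k / 1)) β*κ≡1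
      (ℚ.*-monoˡ-≤-nonNeg (β F t) {{β-nonNegative}} κ≤k))
    (β*k≤β-of*k k 𝒜))

  κ<k⇒ : ∀ k 𝒜 → κ F t <ℚ + k / 1 → 0 < ∣ 𝒜 ⁻[ F , t ] ∣ →
         k * ∣ 𝒜 ⁺[ F , t ] ∣ + ∣ 𝒜 ⁻[ F , t ] ∣ < k * l F t
  κ<k⇒ k 𝒜 κ<k 0<∣𝒜⁻∣ = 1<β-of*k⇒ k 𝒜 0<∣𝒜⁻∣ (ℚ.<-≤-trans
    (subst (_<ℚ β F t ℚ.* (+ k / 1)) β*κ≡1
      (ℚ.*-monoʳ-<-pos (β F t) {{β-positive F t}} κ<k))
    (β*k≤β-of*k k 𝒜))

-- Intersecting and cross-intersecting families

⇒∈⁺ : ∀ {m n} (F : Family m n) t 𝒜 {a} →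
      a ∈ 𝒜 → IntersectsOthers F t 𝒜 a → a ∈ 𝒜 ⁺[ F , t ]
⇒∈⁺ F t 𝒜 {a} a∈𝒜 int = lookup⇒[]= a _
  (trans (lookup∘tabulate _ a)
    (dec-true ((a ∈? 𝒜) ×-dec intersectsOthers? F t 𝒜 a) (a∈𝒜 , int)))

∣⁻∣≡0⇒intersecting : ∀ {m n} (F : Family m n) t 𝒜 →
                     ∣ 𝒜 ⁻[ F , t ] ∣ ≡ 0 → Intersecting F t 𝒜
∣⁻∣≡0⇒intersecting F t 𝒜 ∣𝒜⁻∣≡0 a a∈𝒜 with a ∈? 𝒜 ⁺[ F , t ]
... | yes a∈𝒜⁺ = proj₂ (∈⁺⇒ F t 𝒜 a∈𝒜⁺)
... | no  a∉𝒜⁺ = contradiction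
  (subst₂ _≤_ (∣⁅x⁆∣≡1 a) ∣𝒜⁻∣≡0 (p⊆q⇒∣p∣≤∣q∣ ⁅a⁆⊆𝒜⁻)) λ ()
  where
  ⁅a⁆⊆𝒜⁻ : ⁅ a ⁆ ⊆ 𝒜 ⁻[ F , t ]
  ⁅a⁆⊆𝒜⁻ x∈ = subst (_∈ 𝒜 ⁻[ F , t ]) (sym (x∈⁅y⁆⇒x≡y a x∈))
                (x∈p∧x∉q⇒x∈p─q a∈𝒜 a∉𝒜⁺)

l-attained : ∀ {m n} .{{_ : NonZero m}} (F : Family m n) t →
             ∃[ ℒ ] Intersecting F t ℒ × ∣ ℒ ∣ ≡ l F t
l-attained F t with argmax-sel id 0 (map ∣_∣ (filter (intersecting? F t) (subsets _)))
-- The maximum is either the default 0, excluded by `0<l`, or an entry of the list.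
... | inj₁ l≡0 = contradiction l≡0 (ℕ.>⇒≢ (0<l F t))
... | inj₂ l∈ with ℒ , ℒ∈ , l≡∣ℒ∣ ← ∈-map⁻ ∣_∣ l∈ =
  ℒ , proj₂ (∈-filter⁻ (intersecting? F t) {xs = subsets _} ℒ∈) , sym l≡∣ℒ∣

≥l⇒largest : ∀ {m n} (F : Family m n) t ℒ →
             Intersecting F t ℒ → l F t ≤ ∣ ℒ ∣ → LargestIntersecting F t ℒ
≥l⇒largest F t ℒ int l≤ = int , λ ℬ ℬ-int → ℕ.≤-trans (∣∣≤l F t ℬ ℬ-int) l≤

∣largest∣≡l : ∀ {m n} .{{_ : NonZero m}} (F : Family m n) t ℒ →
              LargestIntersecting F t ℒ → ∣ ℒ ∣ ≡ l F t
∣largest∣≡l F t ℒ (int , max) with ℳ , ℳ-int , ∣ℳ∣≡l ← l-attained F t =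
  ℕ.≤-antisym (∣∣≤l F t ℒ int) (subst (_≤ ∣ ℒ ∣) ∣ℳ∣≡l (max ℳ ℳ-int))

α-attained : ∀ {m n} (F : Family m n) → 1 ≤ α F → ∃[ a ] ∣ member F a ∣ ≡ α F
α-attained F 1≤α with argmax-sel id 0 (map (λ a → ∣ member F a ∣) (allFin _))
... | inj₁ α≡0 = contradiction α≡0 (ℕ.>⇒≢ 1≤α)
... | inj₂ α∈ with a , _ , α≡ ← ∈-map⁻ (λ a → ∣ member F a ∣) α∈ = a , sym α≡

-- Cross-intersection of copies of `ℒ` also compares a member with itself, about which
-- `Intersecting` says nothing; the bound on sizes covers that case.
intersecting-sizes⇒cross : ∀ {m n k} (F : Family m n) t ℒ → Intersecting F t ℒ →
  (∀ a → a ∈ ℒ → t ≤ ∣ member F a ∣) → CrossIntersecting F t (λ (_ : Fin k) → ℒ)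
intersecting-sizes⇒cross F t ℒ int t≤ i j i≢j a b a∈ b∈ with b Fin.≟ a
... | yes refl = subst (λ s → t ≤ ∣ s ∣) (sym (∩-idem (member F a))) (t≤ a a∈)
... | no  b≢a  = int a a∈ b b∈ b≢a

-- With two or more members, each `a` has a partner `b` in `ℒ`, and its intersection with `b`
-- already has `t` elements.
intersecting⇒sizes : ∀ {m n} (F : Family m n) t ℒ → Intersecting F t ℒ → 1 < ∣ ℒ ∣ →
                     ∀ a → a ∈ ℒ → t ≤ ∣ member F a ∣
intersecting⇒sizes F t ℒ int 1<∣ℒ∣ a a∈ with 0<∣∣⇒Nonempty (ℒ ─ ⁅ a ⁆) 0<∣ℒ─a∣
  where
  0<∣ℒ─a∣ : 0 < ∣ ℒ ─ ⁅ a ⁆ ∣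
  0<∣ℒ─a∣ = ℕ.+-cancelˡ-≤ 1 _ _ (ℕ.≤-trans 1<∣ℒ∣
    (subst (λ e → ∣ ℒ ∣ ≤ e + ∣ ℒ ─ ⁅ a ⁆ ∣) (∣⁅x⁆∣≡1 a) (∣p∣≤∣q∣+∣p─q∣ ℒ ⁅ a ⁆)))
... | b , b∈ = ℕ.≤-trans
  (int a a∈ b (p─q⊆p ℒ ⁅ a ⁆ b∈) λ { refl → ∈─⇒∉ ℒ ⁅ a ⁆ b∈ (x∈⁅x⁆ a) })
  (∣p∩q∣≤∣p∣ (member F a) (member F b))

-- If l = 1, then the member of a largest ℒ may have fewer than t elements, and
-- the singleton of a member of size α is taken instead.
cross-intersecting-largest : ∀ {m n k} .{{_ : NonZero m}} (F : Family m n) t → 1 ≤ t → t ≤ α F →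
  ∃[ ℒ ] LargestIntersecting F t ℒ × CrossIntersecting F t (λ (_ : Fin k) → ℒ)
cross-intersecting-largest F t 1≤t t≤α with l-attained F t | 1 ℕ.<? l F t
... | ℒ , int , ∣ℒ∣≡l | yes 1<l =
  ℒ , ≥l⇒largest F t ℒ int (ℕ.≤-reflexive (sym ∣ℒ∣≡l)) ,
  intersecting-sizes⇒cross F t ℒ int
    (intersecting⇒sizes F t ℒ int (subst (1 <_) (sym ∣ℒ∣≡l) 1<l))
... | _ | no 1≮l with a , ∣a∣≡α ← α-attained F (ℕ.≤-trans 1≤t t≤α) =
  ⁅ a ⁆ , ≥l⇒largest F t ⁅ a ⁆ int (subst (l F t ≤_) (sym (∣⁅x⁆∣≡1 a)) (ℕ.≮⇒≥ 1≮l)) ,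
  intersecting-sizes⇒cross F t ⁅ a ⁆ int λ b b∈ →
    subst (λ c → t ≤ ∣ member F c ∣) (sym (x∈⁅y⁆⇒x≡y a b∈)) (subst (t ≤_) (sym ∣a∣≡α) t≤α)
  where
  int : Intersecting F t ⁅ a ⁆
  int b b∈ c c∈ c≢b =
    contradiction (trans (x∈⁅y⁆⇒x≡y a c∈) (sym (x∈⁅y⁆⇒x≡y a b∈))) c≢b

-- Sum bound and equality case through the union of the sub-families

module _ {m n} .{{_ : NonZero m}} (F : Family m n) (t k : ℕ)
         (𝒜 : Fin k → Subset m) (cross : CrossIntersecting F t 𝒜) where

  private
    𝒰 𝒰⁺ 𝒰⁻ : Subset m
    𝒰  = ⋃ (tabulate 𝒜)
    𝒰⁺ = 𝒰 ⁺[ F , t ]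
    𝒰⁻ = 𝒰 ⁻[ F , t ]

  ∈-two⇒∈⁺ : ∀ {i j a} → i ≢ j → a ∈ 𝒜 i → a ∈ 𝒜 j → a ∈ 𝒰⁺
  ∈-two⇒∈⁺ {i} {j} {a} i≢j a∈i a∈j = ⇒∈⁺ F t 𝒰 (∈-⋃⁺ k 𝒜 i a∈i) int
    where
    int : IntersectsOthers F t 𝒰 a
    -- `b` lies in some `𝒜 h`, and `h` differs from at least one of `i` and `j`; `a` is viewed as a
    -- member of that one.
    int b b∈ b≢a with h , b∈h ← ∈-⋃⁻ k 𝒜 b∈ | i Fin.≟ h
    ... | no  i≢h  = cross i h i≢h a b a∈i b∈h
    ... | yes refl = cross j i (i≢j ∘ sym) a b a∈j b∈h

  Σ∣𝒜∣≤ : Σ∣ 𝒜 ∣ ≤ k * ∣ 𝒰⁺ ∣ + ∣ 𝒰⁻ ∣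
  Σ∣𝒜∣≤ = ℕ.≤-trans
    (sum-≤-const+ k _ (λ i → ∣ 𝒜 i ─ 𝒰⁺ ∣) λ i → ∣p∣≤∣q∣+∣p─q∣ (𝒜 i) 𝒰⁺)
    (ℕ.+-monoʳ-≤ (k * ∣ 𝒰⁺ ∣) (Σ∣disjoint∣≤ k (λ i → 𝒜 i ─ 𝒰⁺) 𝒰⁻ ⊆𝒰⁻ disjoint))
    where
    ⊆𝒰⁻ : ∀ i → 𝒜 i ─ 𝒰⁺ ⊆ 𝒰⁻
    ⊆𝒰⁻ i x∈ = x∈p∧x∉q⇒x∈p─q (∈-⋃⁺ k 𝒜 i (p─q⊆p (𝒜 i) 𝒰⁺ x∈)) (∈─⇒∉ (𝒜 i) 𝒰⁺ x∈)

    disjoint : ∀ i j {x} → x ∈ 𝒜 i ─ 𝒰⁺ → x ∈ 𝒜 j ─ 𝒰⁺ → i ≡ j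
    disjoint i j x∈i x∈j with i Fin.≟ j
    ... | yes i≡j = i≡j
    ... | no  i≢j = contradiction
      (∈-two⇒∈⁺ i≢j (p─q⊆p (𝒜 i) 𝒰⁺ x∈i) (p─q⊆p (𝒜 j) 𝒰⁺ x∈j)) (∈─⇒∉ (𝒜 i) 𝒰⁺ x∈i)

  ∣𝒜∣≤l : ∣ 𝒰⁻ ∣ ≡ 0 → ∀ i → ∣ 𝒜 i ∣ ≤ l F t
  ∣𝒜∣≤l ∣𝒰⁻∣≡0 i = ℕ.≤-trans (p⊆q⇒∣p∣≤∣q∣ (∈-⋃⁺ k 𝒜 i))
    (∣∣≤l F t 𝒰 (∣⁻∣≡0⇒intersecting F t 𝒰 ∣𝒰⁻∣≡0))

  Σ∣𝒜∣≤k*l : κ F t ≤ℚ + k / 1 → Σ∣ 𝒜 ∣ ≤ k * l F t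
  Σ∣𝒜∣≤k*l κ≤k with ℕ.m≤n⇒m<n∨m≡n (z≤n {∣ 𝒰⁻ ∣})
  ... | inj₂ 0≡∣𝒰⁻∣ = sum-≤-const k _ (∣𝒜∣≤l (sym 0≡∣𝒰⁻∣))
  ... | inj₁ 0<∣𝒰⁻∣ = ℕ.≤-trans Σ∣𝒜∣≤ (κ≤k⇒ F t k 𝒰 κ≤k 0<∣𝒰⁻∣)

  Σ∣𝒜∣≡k*l⇒ : 1 ≤ k → κ F t <ℚ + k / 1 → Σ∣ 𝒜 ∣ ≡ k * l F t →
              ∃[ ℒ ] LargestIntersecting F t ℒ × (∀ i → 𝒜 i ≡ ℒ)
  Σ∣𝒜∣≡k*l⇒ 1≤k κ<k eq with ℕ.m≤n⇒m<n∨m≡n (z≤n {∣ 𝒰⁻ ∣})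
  ... | inj₁ 0<∣𝒰⁻∣ = contradiction eq
    (ℕ.<⇒≢ (ℕ.≤-<-trans Σ∣𝒜∣≤ (κ<k⇒ F t k 𝒰 κ<k 0<∣𝒰⁻∣)))
  -- The union itself serves as `ℒ`: every `𝒜 i` has `l F t` members, and `𝒰`, being intersecting,
  -- has no more.
  ... | inj₂ 0≡∣𝒰⁻∣ = 𝒰 , ≥l⇒largest F t 𝒰 int l≤∣𝒰∣ , λ i →
    p⊆q∧∣q∣≤∣p∣⇒p≡q (∈-⋃⁺ k 𝒜 i) (subst (∣ 𝒰 ∣ ≤_) (sym (∣𝒜∣≡l i)) (∣∣≤l F t 𝒰 int))
    where
    int : Intersecting F t 𝒰
    int = ∣⁻∣≡0⇒intersecting F t 𝒰 (sym 0≡∣𝒰⁻∣)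

    ∣𝒜∣≡l : ∀ i → ∣ 𝒜 i ∣ ≡ l F t
    ∣𝒜∣≡l = sum-maximal⇒const k _ (∣𝒜∣≤l (sym 0≡∣𝒰⁻∣)) eq

    l≤∣𝒰∣ : l F t ≤ ∣ 𝒰 ∣
    -- Here `1 ≤ k` supplies an index, without which the union would be empty.
    l≤∣𝒰∣ = subst (_≤ ∣ 𝒰 ∣) (∣𝒜∣≡l (fromℕ< 1≤k)) (p⊆q⇒∣p∣≤∣q∣ (∈-⋃⁺ k 𝒜 _))

theorem1p1 : ∀ {m n} .{{_ : NonZero m}} (t k : ℕ) → 1 ≤ t → 1 ≤ k →
    (F : Family m n) → t ≤ α F →
    (𝒜 : Fin k → Subset m) → CrossIntersecting F t 𝒜 →
    κ F t ≤ℚ + k / 1 →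
    (Σ∣ 𝒜 ∣ ≤ k * l F t)
    × (Π∣ 𝒜 ∣ ≤ l F t ^ k)
    × ((∃[ ℒ ] LargestIntersecting F t ℒ × (∀ i → 𝒜 i ≡ ℒ)) →
    (Σ∣ 𝒜 ∣ ≡ k * l F t) × (Π∣ 𝒜 ∣ ≡ l F t ^ k))
    × (∃[ ℒ ] LargestIntersecting F t ℒ × CrossIntersecting F t (λ (_ : Fin k) → ℒ))
    × (κ F t <ℚ + k / 1 →
    (Σ∣ 𝒜 ∣ ≡ k * l F t → ∃[ ℒ ] LargestIntersecting F t ℒ × (∀ i → 𝒜 i ≡ ℒ))
    × (Π∣ 𝒜 ∣ ≡ l F t ^ k → ∃[ ℒ ] LargestIntersecting F t ℒ × (∀ i → 𝒜 i ≡ ℒ)))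
theorem1p1 t k 1≤t 1≤k F t≤α 𝒜 cross κ≤k =
  Σ≤ ,
  sum≤⇒product≤ (l F t) k _ Σ≤ ,
  (λ (ℒ , largest , 𝒜≡ℒ) →
    let ∣𝒜∣≡l = λ i → trans (cong ∣_∣ (𝒜≡ℒ i)) (∣largest∣≡l F t ℒ largest)
    in sum-const k _ ∣𝒜∣≡l , product-const k _ ∣𝒜∣≡l) ,
  -- This shows that the bounds are really attained: some largest `ℒ`, repeated `k` times, is
  -- cross-intersecting.
  cross-intersecting-largest F t 1≤t t≤α ,
  λ κ<k → Σ≡⇒ κ<k , λ Π≡ → Σ≡⇒ κ<k (Π≡⇒Σ≡ Π≡)
  where
  instance
    l≢0 : NonZero (l F t)
    l≢0 = >-nonZero (0<l F t)

  Σ≤ = Σ∣𝒜∣≤k*l F t k 𝒜 cross κ≤k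
  Σ≡⇒ = Σ∣𝒜∣≡k*l⇒ F t k 𝒜 cross 1≤k

  -- By strict AM-GM a sum below `k * l F t` would push the product below `l F t ^ k`, so the
  -- equality case for products reduces to that for sums.
  Π≡⇒Σ≡ : Π∣ 𝒜 ∣ ≡ l F t ^ k → Σ∣ 𝒜 ∣ ≡ k * l F t
  Π≡⇒Σ≡ Π≡ with ℕ.m≤n⇒m<n∨m≡n Σ≤
  ... | inj₁ Σ<kl = contradiction Π≡ (ℕ.<⇒≢ (sum<⇒product< (l F t) k _ Σ<kl))
  ... | inj₂ Σ≡kl = Σ≡kl
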